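{- Let $G$ be a finite partial cube with the opposite-semicube Helly property. Then $G$ is harmonic-even if and only if $G$ is opposite-semicube-isomorphic.
   Context: All graphs are undirected, connected, simple and finite; $d_G$ is the usual shortest-path distance. A partial cube is a graph isomorphic to an isometric subgraph of some hypercube (a subgraph $H$ of $Q$ is isometric if $d_H(x,y)=d_Q(x,y)$ for all $x,y\in V(H)$). The Djokovi\'c–Winkler relation on $E(G)$ is: $uv\,\Theta\,xy$ iff $d_G(u,x)+d_G(v,y)\ne d_G(u,y)+d_G(v,x)$; in a partial cube it is an equivalence relation, and its classes $E_1,\dots,E_d$ are the $\Theta$-classes. For a $\Theta$-class $E_i$ and an edge $xy\in E_i$, the two (opposite) semicubes associated with $E_i$ are $W_i^0=\{a\in V(G): d_G(x,a)<d_G(y,a)\}$ and $W_i^1=\{a\in V(G): d_G(y,a)<d_G(x,a)\}$ (independent of the choice of $xy\in E_i$ up to interchanging the labels $0,1$; they partition $V(G)$). For $x\in V(G)$, $W_i(x)$ denotes the one of $W_i^0,W_i^1$ containing $x$, and $W_i^*(x)$ the other one. $G$ is opposite-semicube-isomorphic if $G[W_i^0]\cong G[W_i^1]$ (induced subgraphs) for every $i\in\{1,\dots,d\}$. $G$ has the opposite-semicube Helly property if for every $x\in V(G)$: whenever $W_i^*(x)\cap W_j^*(x)\ne\emptyset$ for all $1\le i,j\le d$ with $i\ne j$, we have $\bigcap_{i=1}^d W_i^*(x)\ne\emptyset$. An absolute antipode of $x$ is a vertex at distance $\operatorname{diam}(G)$ from $x$. $G$ is even if every vertex $x$ has a unique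 absolute antipode $\bar x$, and harmonic-even if it is even and the map $x\mapsto\bar x$ is an automorphism of $G$. -}

module Defs where

open import Data.Bool using (Bool; true; false; not)
open import Data.Fin using (Fin)
open import Data.Fin.Properties using (any?) renaming (_≟_ to _≟ᶠ_)
open import Data.List using (allFin; cartesianProductWith)
open import Data.List.Extrema.Nat using (max)
open import Data.Nat using (ℕ; zero; suc; _+_; _≤_; _<_; z≤n; s≤s; NonZero)
open import Data.Nat.Properties using (<-irrelevant)
open import Data.Product using (Σ; Σ-syntax; ∃; ∃-syntax; ∃!; _×_; _,_; proj₁; proj₂)
open import Data.Vec using (Vec; lookup)
open import Function using (_∘_)
open import Function.Bundles using (_⇔_)
open import Function.Definitions using (Bijective)
open import Level using (0ℓ)
open import Relation.Binary using (Rel; Symmetric; Irreflexive; Decidable)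
open import Relation.Binary.PropositionalEquality using (_≡_; _≢_; refl; sym)
open import Relation.Nullary using (¬_; Dec; yes; no; contradiction)
open import Relation.Nullary.Decidable using (map′; _×-dec_)
open import Relation.Unary as Unary using (Pred; Irrelevant; _∩_; ⋂; Satisfiable)

record SimpleGraph : Set₁ where
  infix 4 _~_
  field
    V        : Set
    _~_      : Rel V 0ℓ
    ~-sym    : Symmetric _~_
    ~-irrefl : Irreflexive _≡_ _~_

module _ (G : SimpleGraph) where
  open SimpleGraph G

  infixr 5 _∷_
  data Walk : V → V → ℕ → Set where
    []  : ∀ {u} → Walk u u 0
    _∷_ : ∀ {u v w k} → u ~ v → Walk v w k → Walk u w (suc k)

  -- A shortest walk is a path, so this is the usual shortest-path distance;
  -- the relation is empty at pairs of vertices in different components.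
  IsDistance : V → V → ℕ → Set
  IsDistance u v k = Walk u v k × (∀ l → Walk u v l → k ≤ l)

  Connected : Set
  Connected = ∀ u v → ∃[ k ] Walk u v k

module _ (G H : SimpleGraph) where
  private
    module G = SimpleGraph G
    module H = SimpleGraph H

  IsIsomorphism : (G.V → H.V) → Set
  IsIsomorphism f = Bijective _≡_ _≡_ f × (∀ u v → u G.~ v ⇔ f u H.~ f v)

infix 4 _≅_
_≅_ : SimpleGraph → SimpleGraph → Set
G ≅ H = ∃ (IsIsomorphism G H)

IsAutomorphism : (G : SimpleGraph) → (SimpleGraph.V G → SimpleGraph.V G) → Set
IsAutomorphism G = IsIsomorphism G G

-- Irrelevance of vertex membership makes Σ V W a genuine subset of V.
record Subgraph (G : SimpleGraph) : Set₁ where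
  open SimpleGraph G
  field
    W            : Pred V 0ℓ
    W-irrelevant : Irrelevant W
    E            : Rel (Σ V W) 0ℓ
    E-sym        : Symmetric E
    E⊆~          : ∀ {x y} → E x y → proj₁ x ~ proj₁ y

  graph : SimpleGraph
  graph = record
    { V        = Σ V W
    ; _~_      = E
    ; ~-sym    = E-sym
    ; ~-irrefl = λ { refl e → ~-irrefl refl (E⊆~ e) }
    }

-- d_H(x,y) = d_G(x,y) for all vertices x, y of H.
Isometric : {G : SimpleGraph} → Subgraph G → Set
Isometric {G} H = ∀ x y k →
  IsDistance (Subgraph.graph H) x y k ⇔ IsDistance G (proj₁ x) (proj₁ y) k

inducedSubgraph : (G : SimpleGraph) (W : Pred (SimpleGraph.V G) 0ℓ) → Irrelevant W → Subgraph G
inducedSubgraph G W W-irr = record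
  { W            = W
  ; W-irrelevant = W-irr
  ; E            = λ x y → proj₁ x ~ proj₁ y
  ; E-sym        = ~-sym
  ; E⊆~          = λ e → e
  }
  where open SimpleGraph G

-- Vertices are adjacent when they differ in exactly one coordinate.
hypercube : ℕ → SimpleGraph
hypercube k = record
  { V        = Vec Bool k
  ; _~_      = λ u v → ∃! _≡_ (λ i → lookup u i ≢ lookup v i)
  ; ~-sym    = λ { (i , u≢v , unique) → i , u≢v ∘ sym , λ v≢u → unique (v≢u ∘ sym) }
  ; ~-irrefl = λ { refl (i , u≢u , _) → u≢u refl }
  }

-- Finite, simple, undirected, connected, nonempty graphs.
record Graph : Set₁ where
  infix 4 _~_ _~?_
  field
    order        : ℕ
    {{nonempty}} : NonZero order
    _~_          : Rel (Fin order) 0ℓ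
    _~?_         : Decidable _~_
    ~-sym        : Symmetric _~_
    ~-irrefl     : Irreflexive _≡_ _~_

  V : Set
  V = Fin order

  simpleGraph : SimpleGraph
  simpleGraph = record { V = V ; _~_ = _~_ ; ~-sym = ~-sym ; ~-irrefl = ~-irrefl }

  field
    connected : Connected simpleGraph

least : {P : Pred ℕ 0ℓ} → Unary.Decidable P → ∀ k → P k →
        ∃[ m ] P m × (∀ l → P l → m ≤ l)
least P? zero    p = 0 , p , λ _ _ → z≤n
least P? (suc k) p with P? 0
... | yes p₀ = 0 , p₀ , λ _ _ → z≤n
... | no ¬p₀ with least (P? ∘ suc) k p
...   | m , pₘ , min = suc m , pₘ ,
        λ { zero p₀ → contradiction p₀ ¬p₀ ; (suc l) pₗ → s≤s (min l pₗ) }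

module _ (G : Graph) where
  open Graph G

  walk? : ∀ u v k → Dec (Walk simpleGraph u v k)
  walk? u v zero    = map′ (λ { refl → [] }) (λ { [] → refl }) (u ≟ᶠ v)
  walk? u w (suc k) = map′ (λ { (_ , e , p) → e ∷ p }) (λ { (e ∷ p) → _ , e , p })
                           (any? λ v → (u ~? v) ×-dec walk? v w k)

  distance : ∀ u v → ∃ (IsDistance simpleGraph u v)
  distance u v = least (walk? u v) (proj₁ (connected u v)) (proj₂ (connected u v))

  d : V → V → ℕ
  d u v = proj₁ (distance u v)

  diam : ℕ
  diam = max 0 (cartesianProductWith d (allFin order) (allFin order))

  PartialCube : Set₁
  PartialCube = ∃[ k ] Σ[ H ∈ Subgraph (hypercube k) ]
    Isometric H × simpleGraph ≅ Subgraph.graph H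

  -- An edge together with an orientation: reversing it stays in the same
  -- Θ-class and swaps the labels of the two semicubes.
  record Edge : Set where
    constructor edge
    field
      {src tgt} : V
      adjacent  : src ~ tgt

  infix 4 _Θ_
  _Θ_ : Rel Edge 0ℓ
  edge {u} {v} _ Θ edge {x} {y} _ = d u x + d v y ≢ d u y + d v x

  -- The Θ-classes are indexed by their representatives: Edge modulo _Θ_
  -- replaces {1,…,d}, with e and f denoting distinct classes when ¬ (e Θ f).
  -- In a partial cube, Θ-related edges have the same pair of semicubes.
  -- The labels false and true stand for the superscripts 0 and 1.
  Semicube : Edge → Bool → Pred V 0ℓ
  Semicube (edge {x} {y} _) false a = d x a < d y a
  Semicube (edge {x} {y} _) true  a = d y a < d x a

  Semicube-irrelevant : ∀ e b → Irrelevant (Semicube e b)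
  Semicube-irrelevant e false = <-irrelevant
  Semicube-irrelevant e true  = <-irrelevant

  -- The semicube of the class of e that does not contain x.
  W* : Edge → V → Pred V 0ℓ
  W* e x z = ∃[ b ] Semicube e b x × Semicube e (not b) z

  G[Semicube] : Edge → Bool → SimpleGraph
  G[Semicube] e b =
    Subgraph.graph (inducedSubgraph simpleGraph (Semicube e b) (Semicube-irrelevant e b))

  OppositeSemicubeIsomorphic : Set
  OppositeSemicubeIsomorphic = ∀ e → G[Semicube] e false ≅ G[Semicube] e true

  OppositeSemicubeHelly : Set
  OppositeSemicubeHelly = ∀ x →
    (∀ e f → ¬ (e Θ f) → Satisfiable (W* e x ∩ W* f x)) →
    Satisfiable (⋂ Edge (λ e → W* e x))

  AbsoluteAntipode : V → Pred V 0ℓ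
  AbsoluteAntipode x y = d x y ≡ diam

  Even : Set
  Even = ∀ x → ∃! _≡_ (AbsoluteAntipode x)

  antipode : Even → V → V
  antipode even x = proj₁ (even x)

  HarmonicEven : Set
  HarmonicEven = Σ[ even ∈ Even ] IsAutomorphism simpleGraph (antipode even)

{-# OPTIONS --safe #-}

-- Embed G isometrically in a hypercube, so that the semicubes are the sets on
-- which a non-constant coordinate has a given value.
--
-- If G is harmonic-even, then the antipode flips each coordinate i on which
-- some edge uv differs: otherwise d(v,ū) = d(u,ū) + 1 > diam G. Hence it is an
-- automorphism that exchanges opposite semicubes.
--
-- Conversely, isomorphic opposite semicubes have the same size, and then two
-- pairs of opposite semicubes cut V(G) into quadrants such that opposite
-- quadrants have the same size. The quadrant opposite to that of x is therefore
-- nonempty, and the Helly property gives a vertex x̄ that flips all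
-- non-constant coordinates of x. Such vertices are the absolute antipodes.
module Submission where

open import Defs
open import Function.Bundles using (_⇔_)
open import Data.Bool using (Bool; true; false; not; if_then_else_)
open import Data.Bool.Properties using (¬-not; not-¬) renaming (_≟_ to _≟ᵇ_)
open import Data.Fin using (Fin; zero; suc; punchOut)
open import Data.Fin.Properties using (any?; punchOut-injective; injective⇒≤)
  renaming (suc-injective to suc-injectiveᶠ)
open import Data.List.Extrema.Nat using (max≤v⁺; xs≤max)
open import Data.List.Membership.Propositional.Properties using (∈-allFin; ∈-cartesianProductWith⁺)
open import Data.List.Relation.Unary.All as All using ()
open import Data.List.Relation.Unary.All.Properties using (cartesianProductWith⁺)
open import Data.List using (allFin; cartesianProductWith)
open import Data.Nat using (ℕ; zero; suc; _+_; _≤_; z≤n; s≤s)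
open import Data.Nat.Properties
open import Algebra.Properties.CommutativeSemigroup +-commutativeSemigroup using (interchange)
open import Data.Product using (Σ; ∃; ∃-syntax; _×_; _,_; proj₁; proj₂)
open import Data.Vec using (Vec; []; _∷_; lookup)
open import Function using (_∘_; _↣_; mk↣; mk⇔; Injection; Equivalence)
open import Function.Construct.Composition using () renaming (_↣-∘_ to infixr 8 _↣-∘_)
open import Function.Definitions using (Injective)
open import Axiom.UniquenessOfIdentityProofs using (module Decidable⇒UIP)
open import Level using (0ℓ)
open import Relation.Binary.PropositionalEquality
open import Relation.Nullary using (¬_; does; yes; no; contradiction; decidable-stable)
open import Relation.Nullary.Decidable using (_×-dec_)
open import Relation.Unary using (Pred; Decidable; Irrelevant)

open Decidable⇒UIP _≟ᵇ_ using () renaming (≡-irrelevant to ≡ᵇ-irrelevant)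

private
  variable
    k l m n : ℕ
    a b a′ b′ : Bool
    x y z w : Vec Bool k

-- Inequalities between Boolean values.

≢-both : a ≢ b → a′ ≢ a → a′ ≡ b
≢-both a≢b a′≢a = trans (¬-not a′≢a) (sym (¬-not (a≢b ∘ sym)))

≢-flip : a ≢ b → a′ ≢ a → b′ ≢ b → a′ ≢ b′
≢-flip a≢b a′≢a b′≢b a′≡b′ = b′≢b (trans (sym a′≡b′) (≢-both a≢b a′≢a))

-- Finite sets

Σ-≡ : {A : Set} {P : Pred A 0ℓ} → Irrelevant P → {s t : Σ A P} → proj₁ s ≡ proj₁ t → s ≡ t
Σ-≡ P-irr {v , p} {_ , q} refl = cong (v ,_) (P-irr p q)

inclusion : {A : Set} {P Q : Pred A 0ℓ} → Irrelevant P → (∀ v → P v → Q v) → Σ A P ↣ Σ A Q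
inclusion P-irr P⊆Q = mk↣ {to = λ (v , p) → v , P⊆Q v p} (Σ-≡ P-irr ∘ cong proj₁)

-- Punching out the missed value would turn `f` into an injection of `suc n` points into `n` points.
injective⇒¬misses : {f : Fin n → Fin n} → Injective _≡_ _≡_ f → ∀ i → ¬ (∀ j → i ≢ f j)
injective⇒¬misses {suc n} inj i i≢f =
  1+n≰n (injective⇒≤ (λ {j} {k} → inj ∘ punchOut-injective (i≢f j) (i≢f k)))

-- Extended by the identity outside `P`, the injection becomes one of the whole `Fin n`, and it
-- still misses the given point.
↣⇒¬misses : {P : Pred (Fin n) 0ℓ} → Decidable P → Irrelevant P → (f : Σ (Fin n) P ↣ Σ (Fin n) P) →
            ∀ s → ¬ (∀ t → proj₁ s ≢ proj₁ (Injection.to f t))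
↣⇒¬misses {n} {P} P? P-irr f (i , pᵢ) missed = injective⇒¬misses extend-injective i extend-misses
  where
  open Injection f using (to; injective)

  extend : Fin n → Fin n
  extend j with P? j
  ... | yes p = proj₁ (to (j , p))
  ... | no _  = j

  extend-injective : Injective _≡_ _≡_ extend
  extend-injective {j} {k} eq with P? j | P? k
  ... | yes p | yes q = cong proj₁ (injective (Σ-≡ P-irr eq))
  ... | yes p | no ¬q = contradiction (subst P eq (proj₂ (to (j , p)))) ¬q
  ... | no ¬p | yes q = contradiction (subst P (sym eq) (proj₂ (to (k , q)))) ¬p
  ... | no _  | no _  = eq

  extend-misses : ∀ j → i ≢ extend j
  extend-misses j with P? j
  ... | yes p = missed (j , p)
  ... | no ¬p = λ { refl → ¬p pᵢ }

Fibre : (Fin n → Bool) → Bool → Set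
Fibre p b = ∃[ v ] p v ≡ b

-- Both fibres are finite and `b` takes both values, so the two injections express equal size
-- without counting.
Balanced : (Fin n → Bool) → Set
Balanced p = ∀ b → Fibre p b ↣ Fibre p (not b)

opposite-quadrant-inhabited : (p q : Fin n → Bool) → Balanced p → Balanced q →
                              ∀ x → ∃[ z ] p x ≢ p z × q x ≢ q z
opposite-quadrant-inhabited p q p-balanced q-balanced x
  with any? (λ z → p z ≟ᵇ not (p x) ×-dec q z ≟ᵇ not (q x))
... | yes (z , pz , qz) = z , (λ eq → not-¬ (sym eq) pz) , (λ eq → not-¬ (sym eq) qz)
... | no empty =
  -- With the quadrant opposite to x empty, the two balancing injections compose
  -- to a self-injection of x's side of q that misses x.
  contradiction (λ (v , qv) x≡ → not-¬ (cong p (sym x≡)) (proj₂ (to (v , qv))))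
                (↣⇒¬misses (λ v → q v ≟ᵇ q x) (≡ᵇ-irrelevant) round-trip (x , refl))
  where
  out : Fibre q (q x) ↣ Fibre p (not (p x))
  out = p-balanced (p x)
    -- Because the opposite quadrant is empty, a point beyond `x`'s side of `q` must be on `x`'s
    -- side of `p`.
    ↣-∘ inclusion ≡ᵇ-irrelevant (λ v qv → ≢-both (not-¬ refl ∘ sym) λ pv → empty (v , pv , qv))
    ↣-∘ q-balanced (q x)
  open Injection out using (to)

  round-trip : Fibre q (q x) ↣ Fibre q (q x)
  round-trip =
    inclusion ≡ᵇ-irrelevant (λ v pv → ≢-both (not-¬ refl ∘ sym) λ qv → empty (v , pv , qv)) ↣-∘ out

-- Hamming distance

mismatch : Bool → Bool → ℕ
mismatch a b = if does (a ≟ᵇ b) then 0 else 1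

hamming : Vec Bool k → Vec Bool k → ℕ
hamming []      []      = 0
hamming (a ∷ x) (b ∷ y) = mismatch a b + hamming x y

Differ : Vec Bool k → Vec Bool k → Pred (Fin k) 0ℓ
Differ x y i = lookup x i ≢ lookup y i

mismatch-mono : (a ≢ b → a′ ≢ b′) → mismatch a b ≤ mismatch a′ b′
mismatch-mono {a} {b} {a′} {b′} h with a ≟ᵇ b | a′ ≟ᵇ b′
... | yes _   | _         = z≤n
... | no _    | no _      = ≤-refl
... | no a≢b  | yes a′≡b′ = contradiction a′≡b′ (h a≢b)

-- Symmetry, the diameter bound and the contraction property of the opposite map all come from this
-- comparison of sets of differing coordinates.
hamming-mono : (x y z w : Vec Bool k) → (∀ i → Differ x y i → Differ z w i) → hamming x y ≤ hamming z w
hamming-mono []      []      []      []      h = z≤n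
hamming-mono (_ ∷ x) (_ ∷ y) (_ ∷ z) (_ ∷ w) h =
  +-mono-≤ (mismatch-mono (h zero)) (hamming-mono x y z w (h ∘ suc))

hamming-sym : (x y : Vec Bool k) → hamming x y ≡ hamming y x
hamming-sym x y = ≤-antisym (hamming-mono x y y x λ _ → _∘ sym) (hamming-mono y x x y λ _ → _∘ sym)

mismatch-between : ∀ a b c → (a ≢ b → b ≡ c) → mismatch a b + mismatch b c ≡ mismatch a c
mismatch-between false false c     _ = refl
mismatch-between true  true  c     _ = refl
mismatch-between false true  true  _ = refl
mismatch-between true  false false _ = refl
mismatch-between false true  false h = contradiction (sym (h λ ())) λ ()
mismatch-between true  false true  h = contradiction (sym (h λ ())) λ ()

-- The hypothesis puts `y` on a geodesic from `x` to `z`: a coordinate changed on the way to `y`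
-- already has its final value and is not changed again.
hamming-between : (x y z : Vec Bool k) → (∀ i → Differ x y i → lookup y i ≡ lookup z i) →
                  hamming x y + hamming y z ≡ hamming x z
hamming-between []      []      []      h = refl
hamming-between (a ∷ x) (b ∷ y) (c ∷ z) h = trans
  (interchange (mismatch a b) (hamming x y) (mismatch b c) (hamming y z))
  (cong₂ _+_ (mismatch-between a b c (h zero)) (hamming-between x y z (h ∘ suc)))

mismatch-refl : a ≡ b → mismatch a b ≡ 0
mismatch-refl {false} refl = refl
mismatch-refl {true}  refl = refl

mismatch-≢ : a ≢ b → mismatch a b ≡ 1
mismatch-≢ {false} {false} h = contradiction refl h
mismatch-≢ {false} {true}  h = refl
mismatch-≢ {true}  {false} h = refl
mismatch-≢ {true}  {true}  h = contradiction refl h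

hamming-≗ : (x y : Vec Bool k) → (∀ i → lookup x i ≡ lookup y i) → hamming x y ≡ 0
hamming-≗ []      []      h = refl
hamming-≗ (_ ∷ x) (_ ∷ y) h = cong₂ _+_ (mismatch-refl (h zero)) (hamming-≗ x y (h ∘ suc))

-- Hypercubes

infix 4 _~ʰ_
_~ʰ_ : Vec Bool k → Vec Bool k → Set
_~ʰ_ {k} = SimpleGraph._~_ (hypercube k)

agree-elsewhere : (x y : Vec Bool k) (i j : Fin k) → x ~ʰ y → Differ x y i → j ≢ i → lookup x j ≡ lookup y j
agree-elsewhere x y i j (_ , _ , unique) xᵢ≢yᵢ j≢i =
  decidable-stable (lookup x j ≟ᵇ lookup y j) λ xⱼ≢yⱼ → j≢i (trans (sym (unique xⱼ≢yⱼ)) (unique xᵢ≢yᵢ))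

hamming-adjacent : (x y : Vec Bool k) → x ~ʰ y → hamming x y ≡ 1
hamming-adjacent x₀∷x@(_ ∷ x) y₀∷y@(_ ∷ y) x~y@(zero , x₀≢y₀ , _) =
  cong₂ _+_ (mismatch-≢ x₀≢y₀) (hamming-≗ x y λ j → agree-elsewhere x₀∷x y₀∷y zero (suc j) x~y x₀≢y₀ λ ())
hamming-adjacent x₀∷x@(_ ∷ x) y₀∷y@(_ ∷ y) x~y@(suc i , xᵢ≢yᵢ , unique) =
  cong₂ _+_ (mismatch-refl (agree-elsewhere x₀∷x y₀∷y (suc i) zero x~y xᵢ≢yᵢ λ ()))
            (hamming-adjacent x y (i , xᵢ≢yᵢ , λ xⱼ≢yⱼ → suc-injectiveᶠ (unique xⱼ≢yⱼ)))

-- Moving from `y` to `x` only corrects coordinate `i` to its value in `z`, so `x` lies between `y`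
-- and `z`.
hamming-step : (x y z : Vec Bool k) {i : Fin k} → x ~ʰ y → Differ x y i → lookup z i ≡ lookup x i →
               hamming y z ≡ suc (hamming x z)
hamming-step x y z {i} x~y xᵢ≢yᵢ zᵢ≡xᵢ = begin
  hamming y z               ≡⟨ hamming-between y x z between ⟨
  hamming y x + hamming x z ≡⟨ cong (_+ hamming x z) (hamming-sym y x) ⟩
  hamming x y + hamming x z ≡⟨ cong (_+ hamming x z) (hamming-adjacent x y x~y) ⟩
  suc (hamming x z)         ∎
  where
  open ≡-Reasoning
  between : ∀ j → Differ y x j → lookup x j ≡ lookup z j
  between j yⱼ≢xⱼ with trans (sym (proj₂ (proj₂ x~y) (yⱼ≢xⱼ ∘ sym))) (proj₂ (proj₂ x~y) xᵢ≢yᵢ)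
  ... | refl = sym zᵢ≡xᵢ

module _ {G H : SimpleGraph} (f : SimpleGraph.V G → SimpleGraph.V H)
         (f-adj : ∀ {u v} → SimpleGraph._~_ G u v → SimpleGraph._~_ H (f u) (f v)) where

  map-walk : ∀ {u v} → Walk G u v l → Walk H (f u) (f v) l
  map-walk []      = []
  map-walk (e ∷ p) = f-adj e ∷ map-walk p

∷-adjacent : x ~ʰ y → (a ∷ x) ~ʰ (a ∷ y)
∷-adjacent (i , xᵢ≢yᵢ , unique) = suc i , xᵢ≢yᵢ ,
  λ { {zero} a≢a → contradiction refl a≢a ; {suc j} xⱼ≢yⱼ → cong suc (unique xⱼ≢yⱼ) }

head-adjacent : a ≢ b → (a ∷ x) ~ʰ (b ∷ x)
head-adjacent a≢b = zero , a≢b , λ { {zero} _ → refl ; {suc j} xⱼ≢xⱼ → contradiction refl xⱼ≢xⱼ }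

-- The differing coordinates are corrected one at a time, from the first to the last.
hamming-walk : (x y : Vec Bool k) → Walk (hypercube k) x y (hamming x y)
hamming-walk []      []      = []
hamming-walk (a ∷ x) (b ∷ y) with a ≟ᵇ b
... | yes refl = map-walk (a ∷_) ∷-adjacent (hamming-walk x y)
... | no a≢b   = head-adjacent a≢b ∷ map-walk (b ∷_) ∷-adjacent (hamming-walk x y)

-- Induction on the walk: its first edge changes the Hamming distance to the target by exactly one,
-- upwards if the target agrees with `x` at the flipped coordinate and downwards otherwise.
hamming-minimal : Walk (hypercube k) x y l → hamming x y ≤ l
hamming-minimal {x = x} [] = ≤-reflexive (hamming-≗ x x λ _ → refl)
hamming-minimal {x = x} {y = z} (_∷_ {v = y} x~y@(i , xᵢ≢yᵢ , _) p)
  with lookup z i ≟ᵇ lookup x i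
... | yes zᵢ≡xᵢ = begin
  hamming x z       ≤⟨ n≤1+n _ ⟩
  suc (hamming x z) ≡⟨ hamming-step x y z x~y xᵢ≢yᵢ zᵢ≡xᵢ ⟨
  hamming y z       ≤⟨ hamming-minimal p ⟩
  _                 ≤⟨ n≤1+n _ ⟩
  _                 ∎
  where open ≤-Reasoning
... | no zᵢ≢xᵢ  = begin
  hamming x z       ≡⟨ hamming-step y x z y~x (xᵢ≢yᵢ ∘ sym) (≢-both xᵢ≢yᵢ zᵢ≢xᵢ) ⟩
  suc (hamming y z) ≤⟨ s≤s (hamming-minimal p) ⟩
  _                 ∎
  where
  open ≤-Reasoning
  y~x : y ~ʰ x
  y~x = SimpleGraph.~-sym (hypercube _) {x} {y} x~y

hamming-isDistance : (x y : Vec Bool k) → IsDistance (hypercube k) x y (hamming x y)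
hamming-isDistance x y = hamming-walk x y , λ _ → hamming-minimal

-- Distances in graphs

IsDistance-unique : (G : SimpleGraph) → ∀ {u v} → IsDistance G u v m → IsDistance G u v n → m ≡ n
IsDistance-unique G (p , p-min) (q , q-min) = ≤-antisym (p-min _ q) (q-min _ p)

module _ {G H : SimpleGraph} (iso : G ≅ H) where
  private
    f      = proj₁ iso
    f-inj  = proj₁ (proj₁ (proj₂ iso))
    f-surj = proj₂ (proj₁ (proj₂ iso))
    f-adj  = proj₂ (proj₂ iso)

  -- The endpoints enter through equations, so that matching on the walk need not unify its indices
  -- with values of `f`.
  reflect-walk : ∀ {s t} → Walk H s t l → ∀ {u v} → s ≡ f u → t ≡ f v → Walk G u v l
  reflect-walk [] {u} s≡fu t≡fv with f-inj (trans (sym s≡fu) t≡fv)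
  ... | refl = []
  reflect-walk (_∷_ {v = t} e p) refl t≡fv with f-surj t
  ... | w , fw≡t with fw≡t refl
  ...   | refl = Equivalence.from (f-adj _ w) e ∷ reflect-walk p refl t≡fv

  ≅-IsDistance : ∀ {u v} → IsDistance G u v l → IsDistance H (f u) (f v) l
  ≅-IsDistance (p , p-min) =
    map-walk f (Equivalence.to (f-adj _ _)) p , λ m q → p-min m (reflect-walk q refl refl)

module _ (G : Graph) where
  open Graph G

  private
    ds = cartesianProductWith (d G) (allFin order) (allFin order)

  d≤diam : ∀ u v → d G u v ≤ diam G
  d≤diam u v = All.lookup (xs≤max 0 ds) (∈-cartesianProductWith⁺ (d G) (∈-allFin u) (∈-allFin v))

  diam≤ : (∀ u v → d G u v ≤ m) → diam G ≤ m
  diam≤ d≤m = max≤v⁺ z≤n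
    (cartesianProductWith⁺ (setoid V) (setoid V) (d G) (allFin order) (allFin order) λ {u} {v} _ _ → d≤m u v)

  endpoint : Edge G → Bool → V
  endpoint (edge {x} {y} _) false = x
  endpoint (edge {x} {y} _) true  = y

  -- From `true` to `false` the map is a section of the surjection, which is injective because `f`
  -- undoes it.
  opposite-semicube-↣ : OppositeSemicubeIsomorphic G → ∀ e b →
    Σ V (Semicube G e b) ↣ Σ V (Semicube G e (not b))
  opposite-semicube-↣ iso e false = let _ , (inj , _) , _ = iso e in mk↣ inj
  opposite-semicube-↣ iso e true  = let f , (_ , surj) , _ = iso e in
    mk↣ {to = proj₁ ∘ surj} λ {s} {t} eq →
      trans (sym (proj₂ (surj s) refl)) (trans (cong f eq) (proj₂ (surj t) refl))

-- Distances and semicubes in hypercube coordinates.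

module IsometricEmbedding (G : Graph) {k : ℕ} (c : Graph.V G → Vec Bool k)
  (c-adj : ∀ {u v} → Graph._~_ G u v → c u ~ʰ c v)
  (d≡hamming : ∀ u v → d G u v ≡ hamming (c u) (c v)) where
  open Graph G

  d-sym : ∀ u v → d G u v ≡ d G v u
  d-sym u v = trans (d≡hamming u v) (trans (hamming-sym (c u) (c v)) (sym (d≡hamming v u)))

  d-mono : ∀ {u v x y} → (∀ i → Differ (c u) (c v) i → Differ (c x) (c y) i) → d G u v ≤ d G x y
  d-mono h = subst₂ _≤_ (sym (d≡hamming _ _)) (sym (d≡hamming _ _)) (hamming-mono (c _) (c _) (c _) (c _) h)

  d-between : ∀ u v w → (∀ i → Differ (c u) (c v) i → lookup (c v) i ≡ lookup (c w) i) →
              d G u v + d G v w ≡ d G u w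
  d-between u v w h = begin
    d G u v + d G v w                           ≡⟨ cong₂ _+_ (d≡hamming u v) (d≡hamming v w) ⟩
    hamming (c u) (c v) + hamming (c v) (c w)   ≡⟨ hamming-between (c u) (c v) (c w) h ⟩
    hamming (c u) (c w)                         ≡⟨ d≡hamming u w ⟨
    d G u w                                     ∎
    where open ≡-Reasoning

  d≡0⇒≡ : ∀ u v → d G u v ≡ 0 → u ≡ v
  d≡0⇒≡ u v eq with subst (Walk simpleGraph u v) eq (proj₁ (proj₂ (distance G u v)))
  ... | [] = refl

  d≡1⇒~ : ∀ u v → d G u v ≡ 1 → u ~ v
  d≡1⇒~ u v eq with subst (Walk simpleGraph u v) eq (proj₁ (proj₂ (distance G u v)))
  ... | u~v ∷ [] = u~v

  ~⇒d≡1 : ∀ {u v} → u ~ v → d G u v ≡ 1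
  ~⇒d≡1 u~v = trans (d≡hamming _ _) (hamming-adjacent (c _) (c _) (c-adj u~v))

  d-step : ∀ {u v} w {i} → u ~ v → Differ (c u) (c v) i → lookup (c w) i ≡ lookup (c u) i →
           d G v w ≡ suc (d G u w)
  d-step {u} {v} w u~v uᵢ≢vᵢ wᵢ≡uᵢ = begin
    d G v w                     ≡⟨ d≡hamming v w ⟩
    hamming (c v) (c w)         ≡⟨ hamming-step (c u) (c v) (c w) (c-adj u~v) uᵢ≢vᵢ wᵢ≡uᵢ ⟩
    suc (hamming (c u) (c w))   ≡⟨ cong suc (d≡hamming u w) ⟨
    suc (d G u w)               ∎
    where open ≡-Reasoning

  -- A coordinate cut by some edge stands for a Θ-class, namely that of all edges cutting it.
  Cuts : Edge G → Pred (Fin k) 0ℓ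
  Cuts (edge {u} {v} _) = Differ (c u) (c v)

  cut-of : ∀ e → ∃ (Cuts e)
  cut-of (edge u~v) = let i , uᵢ≢vᵢ , _ = c-adj u~v in i , uᵢ≢vᵢ

  -- The coordinate has to change at some edge of the walk. Hence, by connectedness, each
  -- non-constant coordinate comes from an edge.
  walk-crosses : ∀ {u v i} → Walk simpleGraph u v l → Differ (c u) (c v) i → ∃[ e ] Cuts e i
  walk-crosses [] uᵢ≢uᵢ = contradiction refl uᵢ≢uᵢ
  walk-crosses {u = u} {i = i} (_∷_ {v = w} u~w p) uᵢ≢vᵢ with lookup (c u) i ≟ᵇ lookup (c w) i
  ... | yes uᵢ≡wᵢ = walk-crosses p (uᵢ≢vᵢ ∘ trans uᵢ≡wᵢ)
  ... | no uᵢ≢wᵢ  = edge u~w , uᵢ≢wᵢ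

  Differ⇒cut : ∀ {u v i} → Differ (c u) (c v) i → ∃[ e ] Cuts e i
  Differ⇒cut = walk-crosses (proj₂ (connected _ _))

  -- By `d-step`, the endpoint that agrees with `z` at the cut coordinate is nearer to `z` by
  -- exactly one.
  semicube⁺ : ∀ {i z} e b → Cuts e i → lookup (c z) i ≡ lookup (c (endpoint G e b)) i → Semicube G e b z
  semicube⁺ {z = z} (edge x~y) false cut zᵢ≡xᵢ = ≤-reflexive (sym (d-step z x~y cut zᵢ≡xᵢ))
  semicube⁺ {z = z} (edge x~y) true  cut zᵢ≡yᵢ = ≤-reflexive (sym (d-step z (~-sym x~y) (cut ∘ sym) zᵢ≡yᵢ))

  -- Otherwise `z` agrees with the other endpoint and would lie in both semicubes.
  semicube⁻ : ∀ {i z} e b → Cuts e i → Semicube G e b z → lookup (c z) i ≡ lookup (c (endpoint G e b)) i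
  semicube⁻ {i} {z} e@(edge {x} {y} _) false cut x<y = decidable-stable (lookup (c z) i ≟ᵇ lookup (c x) i)
    λ zᵢ≢xᵢ → <-asym x<y (semicube⁺ e true cut (≢-both cut zᵢ≢xᵢ))
  semicube⁻ {i} {z} e@(edge {x} {y} _) true cut y<x = decidable-stable (lookup (c z) i ≟ᵇ lookup (c y) i)
    λ zᵢ≢yᵢ → <-asym y<x (semicube⁺ e false cut (≢-both (cut ∘ sym) zᵢ≢yᵢ))

  endpoints-differ : ∀ {i} e b → Cuts e i → Differ (c (endpoint G e b)) (c (endpoint G e (not b))) i
  endpoints-differ (edge _) false cut = cut
  endpoints-differ (edge _) true  cut = cut ∘ sym

  which-endpoint : ∀ {i} e → Cuts e i → ∀ a → ∃[ b ] a ≡ lookup (c (endpoint G e b)) i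
  which-endpoint {i} (edge {x} _) cut a with a ≟ᵇ lookup (c x) i
  ... | yes a≡xᵢ = false , a≡xᵢ
  ... | no a≢xᵢ  = true , ≢-both cut a≢xᵢ

  W*⁺ : ∀ {e i x z} → Cuts e i → Differ (c x) (c z) i → W* G e x z
  W*⁺ {e} {i} {x} cut xᵢ≢zᵢ with which-endpoint e cut (lookup (c x) i)
  ... | b , xᵢ≡bᵢ = b , semicube⁺ e b cut xᵢ≡bᵢ , semicube⁺ e (not b) cut
    (≢-both (endpoints-differ e b cut) (λ zᵢ≡bᵢ → xᵢ≢zᵢ (trans xᵢ≡bᵢ (sym zᵢ≡bᵢ))))

  W*⁻ : ∀ {e i x z} → Cuts e i → W* G e x z → Differ (c x) (c z) i
  W*⁻ {e} cut (b , x∈b , z∈¬b) xᵢ≡zᵢ = endpoints-differ e b cut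
    (trans (sym (semicube⁻ e b cut x∈b)) (trans xᵢ≡zᵢ (semicube⁻ e (not b) cut z∈¬b)))

  -- Antipodes exchange opposite semicubes.

  module _ (even : Even G) (automorphism : IsAutomorphism simpleGraph (antipode G even)) where
    private
      α = antipode G even

    antipode-involutive : ∀ u → α (α u) ≡ u
    antipode-involutive u =
      proj₂ (proj₂ (even (α u))) (trans (d-sym (α u) u) (proj₁ (proj₂ (even u))))

    antipode-flips-at-edge : ∀ {u v i} → u ~ v → Differ (c u) (c v) i → Differ (c (α u)) (c u) i
    antipode-flips-at-edge {u} {v} u~v uᵢ≢vᵢ αuᵢ≡uᵢ = 1+n≰n (begin
      suc (diam G)      ≡⟨ cong suc (proj₁ (proj₂ (even u))) ⟨
      suc (d G u (α u)) ≡⟨ d-step (α u) u~v uᵢ≢vᵢ αuᵢ≡uᵢ ⟨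
      d G v (α u)       ≤⟨ d≤diam G v (α u) ⟩
      diam G            ∎)
      where open ≤-Reasoning

    -- If the edge cuts `i`, the flip at an edge applies directly. If it cuts another coordinate
    -- `j`, the images `α u` and `α w` are adjacent, since `α` is an automorphism, and they differ
    -- at `j`. Thus they agree at `i`, as do `u` and `w`, and the flip carries over.
    antipode-flips-next : ∀ {u w i} → u ~ w → Differ (c (α u)) (c u) i → Differ (c (α w)) (c w) i
    antipode-flips-next {u} {w} {i} u~w αuᵢ≢uᵢ with lookup (c w) i ≟ᵇ lookup (c u) i
    ... | no wᵢ≢uᵢ  = antipode-flips-at-edge (~-sym u~w) wᵢ≢uᵢ
    ... | yes wᵢ≡uᵢ with c-adj u~w
    ...   | j , uⱼ≢wⱼ , _ = λ αwᵢ≡wᵢ → αuᵢ≢uᵢ (trans αuᵢ≡αwᵢ (trans αwᵢ≡wᵢ wᵢ≡uᵢ))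
      where
      αuᵢ≡αwᵢ : lookup (c (α u)) i ≡ lookup (c (α w)) i
      αuᵢ≡αwᵢ = agree-elsewhere (c (α u)) (c (α w)) j i (c-adj (Equivalence.to (proj₂ automorphism u w) u~w))
        (≢-flip uⱼ≢wⱼ (antipode-flips-at-edge u~w uⱼ≢wⱼ)
                      (antipode-flips-at-edge (~-sym u~w) (uⱼ≢wⱼ ∘ sym)))
        λ { refl → uⱼ≢wⱼ (sym wᵢ≡uᵢ) }

    antipode-flips-along : ∀ {u w i} → Walk simpleGraph u w l →
      Differ (c (α u)) (c u) i → Differ (c (α w)) (c w) i
    antipode-flips-along []      = λ h → h
    antipode-flips-along (e ∷ p) = antipode-flips-along p ∘ antipode-flips-next e

    antipode-flips : ∀ {i} e → Cuts e i → ∀ z → Differ (c (α z)) (c z) i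
    antipode-flips (edge x~y) cut z =
      antipode-flips-along (proj₂ (connected _ z)) (antipode-flips-at-edge x~y cut)

    antipode-swaps : ∀ e b {z} → Semicube G e b z → Semicube G e (not b) (α z)
    antipode-swaps e b {z} z∈b with cut-of e
    ... | i , cut = semicube⁺ e (not b) cut (≢-both (endpoints-differ e b cut)
      (λ αzᵢ≡bᵢ → antipode-flips e cut z (trans αzᵢ≡bᵢ (sym (semicube⁻ e b cut z∈b)))))

    harmonic⇒isomorphic : OppositeSemicubeIsomorphic G
    harmonic⇒isomorphic e = f , (f-injective , f-surjective) , λ s t → proj₂ automorphism (proj₁ s) (proj₁ t)
      where
      f : Σ V (Semicube G e false) → Σ V (Semicube G e true)
      f (z , z∈0) = α z , antipode-swaps e false z∈0

      f-injective : ∀ {s t} → f s ≡ f t → s ≡ t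
      f-injective eq = Σ-≡ (Semicube-irrelevant G e false) (proj₁ (proj₁ automorphism) (cong proj₁ eq))

      f-surjective : ∀ t → ∃[ s ] (∀ {r} → r ≡ s → f r ≡ t)
      f-surjective (z , z∈1) = (α z , antipode-swaps e true z∈1) ,
        λ { refl → Σ-≡ (Semicube-irrelevant G e true) (antipode-involutive z) }

  -- Opposite vertices from isomorphic semicubes.

  isomorphic⇒balanced : OppositeSemicubeIsomorphic G → ∀ e {i} → Cuts e i → Balanced (λ z → lookup (c z) i)
  isomorphic⇒balanced iso e {i} cut a with which-endpoint e cut a
  ... | b , a≡bᵢ =
    -- The fibres of a cut coordinate are the two semicubes of `e`, and `b` marks the endpoint with
    -- value `a`.
    inclusion (Semicube-irrelevant G e (not b)) (λ _ z∈¬b → trans (semicube⁻ e (not b) cut z∈¬b)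
        (¬-not λ ¬bᵢ≡a → endpoints-differ e b cut (sym (trans ¬bᵢ≡a a≡bᵢ))))
      ↣-∘ opposite-semicube-↣ G iso e b
      ↣-∘ inclusion ≡ᵇ-irrelevant (λ _ zᵢ≡a → semicube⁺ e b cut (trans zᵢ≡a a≡bᵢ))

  isomorphic⇒opposite : OppositeSemicubeIsomorphic G → OppositeSemicubeHelly G →
                        ∀ x → ∃[ x̄ ] (∀ e {i} → Cuts e i → Differ (c x) (c x̄) i)
  isomorphic⇒opposite iso helly x =
    let x̄ , x̄∈⋂ = helly x λ e f _ →
          let i , e-cut = cut-of e
              j , f-cut = cut-of f
              z , xᵢ≢zᵢ , xⱼ≢zⱼ = opposite-quadrant-inhabited _ _
                (isomorphic⇒balanced iso e e-cut) (isomorphic⇒balanced iso f f-cut) x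
          in z , W*⁺ e-cut xᵢ≢zᵢ , W*⁺ f-cut xⱼ≢zⱼ
    in x̄ , λ e cut → W*⁻ cut (x̄∈⋂ e)

  -- Opposite vertices are absolute antipodes.

  module _ (opposite : ∀ x → ∃[ x̄ ] (∀ e {i} → Cuts e i → Differ (c x) (c x̄) i)) where
    private
      α : V → V
      α x = proj₁ (opposite x)

    opposite-flips : ∀ {u v i} → Differ (c u) (c v) i → ∀ x → Differ (c x) (c (α x)) i
    opposite-flips uᵢ≢vᵢ x = let e , cut = Differ⇒cut uᵢ≢vᵢ in proj₂ (opposite x) e cut

    -- Any coordinate in which some `u` and `v` differ also separates `x` from `α x`, so no distance
    -- exceeds this one.
    d-opposite : ∀ x → d G x (α x) ≡ diam G
    d-opposite x = ≤-antisym (d≤diam G x (α x)) (diam≤ G λ u v → d-mono λ i uᵢ≢vᵢ → opposite-flips uᵢ≢vᵢ x)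

    -- Where `y` differs from `x` it equals `α x`, so it lies on a geodesic from `x` to `α x`. Both
    -- ends of the comparison have length `diam G`, which leaves distance zero from `y` to `α x`.
    opposite-unique : ∀ x {y} → d G x y ≡ diam G → α x ≡ y
    opposite-unique x {y} dxy≡diam = sym (d≡0⇒≡ y (α x) (+-cancelˡ-≡ (d G x y) _ _ (begin
      d G x y + d G y (α x) ≡⟨ d-between x y (α x) (λ i xᵢ≢yᵢ →
        sym (≢-both xᵢ≢yᵢ (opposite-flips xᵢ≢yᵢ x ∘ sym))) ⟩
      d G x (α x)           ≡⟨ d-opposite x ⟩
      diam G                ≡⟨ dxy≡diam ⟨
      d G x y               ≡⟨ +-identityʳ _ ⟨
      d G x y + 0           ∎)))
      where open ≡-Reasoning

    opposite-involutive : ∀ x → α (α x) ≡ x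
    opposite-involutive x = opposite-unique (α x) (trans (d-sym (α x) x) (d-opposite x))

    opposite-contracts : ∀ u v → d G (α u) (α v) ≤ d G u v
    opposite-contracts u v = d-mono λ i αuᵢ≢αvᵢ →
      ≢-flip αuᵢ≢αvᵢ (opposite-flips αuᵢ≢αvᵢ u) (opposite-flips αuᵢ≢αvᵢ v)

    -- A contracting involution is isometric: contracting `α u` and `α v` leads back to `u` and `v`.
    opposite-isometric : ∀ u v → d G (α u) (α v) ≡ d G u v
    opposite-isometric u v = ≤-antisym (opposite-contracts u v)
      (subst₂ (λ u′ v′ → d G u′ v′ ≤ d G (α u) (α v)) (opposite-involutive u) (opposite-involutive v)
        (opposite-contracts (α u) (α v)))

    opposite⇒harmonic : HarmonicEven G
    opposite⇒harmonic = (λ x → α x , d-opposite x , opposite-unique x) , (α-injective , α-surjective) , λ u v →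
      mk⇔ (λ u~v → d≡1⇒~ _ _ (trans (opposite-isometric u v) (~⇒d≡1 u~v)))
          (λ αu~αv → d≡1⇒~ _ _ (trans (sym (opposite-isometric u v)) (~⇒d≡1 αu~αv)))
      where
      α-injective : ∀ {u v} → α u ≡ α v → u ≡ v
      α-injective eq = trans (sym (opposite-involutive _)) (trans (cong α eq) (opposite-involutive _))

      α-surjective : ∀ v → ∃[ u ] (∀ {w} → w ≡ u → α w ≡ v)
      α-surjective v = α v , λ { refl → opposite-involutive v }

corollary5p5 : (G : Graph) → PartialCube G → OppositeSemicubeHelly G →
    HarmonicEven G ⇔ OppositeSemicubeIsomorphic G
corollary5p5 G (k , H , isometric , iso@(φ , _ , φ-adj)) helly =
  mk⇔ (λ (even , automorphism) → harmonic⇒isomorphic even automorphism)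
      (λ isomorphic → opposite⇒harmonic (isomorphic⇒opposite isomorphic helly))
  where
  open IsometricEmbedding G (proj₁ ∘ φ)
    (λ u~v → Subgraph.E⊆~ H (Equivalence.to (φ-adj _ _) u~v))
    -- The isomorphism carries the distance of `G` to `H` and isometry carries it on to the
    -- hypercube, where it must be the Hamming distance.
    (λ u v → IsDistance-unique (hypercube k)
      (Equivalence.to (isometric (φ u) (φ v) _) (≅-IsDistance iso (proj₂ (distance G u v))))
      (hamming-isDistance (proj₁ (φ u)) (proj₁ (φ v))))
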